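{- Let $x_1,x_2\ge 0$. If $x_1+x_2\le 5/11$, then $C_3(x_1,x_2)\le 11/6\le 2.012096$.
   Context: Let $F(z)=\min\{(11/6)z,1\}$ for $z\in[0,1]$, and let $F'(z)=11/6$ for $z\in[0,6/11]$ and $F'(z)=0$ otherwise. For $x_1,x_2,x_3\ge 0$ with $x_1+x_2+x_3=1$ define $$d_3(x_1,x_2,x_3)=\frac{1}{3!}\sum_{\sigma}\Big(F'(x_1)\prod_{i:\sigma(i)<\sigma(1)}[1-F(x_i)]+F'(x_2)\prod_{i:\sigma(i)<\sigma(2)}[1-F(x_i)]\Big),$$ the sum being over all permutations $\sigma$ of $\{1,2,3\}$, and define $C_3(x_1,x_2)=d_3(x_1,x_2,1-x_1-x_2)$. -}

module Defs where

open import Data.Fin.Base using (Fin)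
open import Data.Fin.Patterns using (0F; 1F; 2F)
open import Data.Fin.Permutation using (Permutation′; _⟨$⟩ʳ_; insert; id)
open import Data.Fin.Properties using (_<?_)
open import Data.Integer.Base using (+_)
open import Data.List.Base using (List; []; _∷_; [_]; map; foldr; filter; allFin; concatMap)
open import Data.Nat.Base using (ℕ; zero; suc; _!)
import Data.Nat.Base as ℕ
import Data.Nat.Properties as ℕ
open import Data.Product.Base using (∃-syntax; _×_; _,_)
open import Data.Rational.Base using (ℚ; 0ℚ; 1ℚ; ½; ∣_∣; _/_; 1/_; Positive; NonZero; positive; nonNegative)
import Data.Rational.Base as ℚ
import Data.Rational.Properties as ℚ
open import Data.Rational.Solver using (module +-*-Solver)
open import Data.Sum.Base using (inj₁; inj₂)
open import Data.Vec.Base using ([]; _∷_; lookup; tabulate)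
open import Relation.Binary.PropositionalEquality using (_≡_; refl; sym; trans; cong; cong₂; subst; subst₂)
open import Relation.Nullary.Decidable using (Dec; yes; no)

------------------------------------------------------------------------
-- Real numbers as Cauchy sequences of rationals

-- Two sequences denote the same real number when each is ≤ the other in
-- the order _≤_ below; no quotient is taken.

IsCauchy : (ℕ → ℚ) → Set
IsCauchy s = ∀ ε → 0ℚ ℚ.< ε →
  ∃[ N ] (∀ m n → N ℕ.≤ m → N ℕ.≤ n → ∣ s m ℚ.- s n ∣ ℚ.≤ ε)

record ℝ : Set where
  constructor mkℝ
  field
    seq    : ℕ → ℚ
    cauchy : IsCauchy seq

open ℝ public

infix 4 _≤_

_≤_ : ℝ → ℝ → Set
x ≤ y = ∀ ε → 0ℚ ℚ.< ε → ∃[ N ] (∀ n → N ℕ.≤ n → seq x n ℚ.≤ seq y n ℚ.+ ε)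

private
  open +-*-Solver using (solve; con; _:=_; _:+_; _:*_; :-_; _:-_)

  half-pos : ∀ {ε} → 0ℚ ℚ.< ε → 0ℚ ℚ.< ½ ℚ.* ε
  half-pos {ε} 0<ε =
    subst (ℚ._< ½ ℚ.* ε) (ℚ.*-zeroʳ ½) (ℚ.*-monoʳ-<-pos ½ 0<ε)

  halves : ∀ ε → ½ ℚ.* ε ℚ.+ ½ ℚ.* ε ≡ ε
  halves = solve 1 (λ e → con ½ :* e :+ con ½ :* e := e) refl

  cancel : ∀ p q → q ℚ.+ (p ℚ.- q) ≡ p
  cancel = solve 2 (λ a b → b :+ (a :- b) := a) refl

  cancel′ : ∀ q ε → (q ℚ.+ ε) ℚ.- q ≡ ε
  cancel′ = solve 2 (λ b e → (b :+ e) :- b := e) refl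

  neg-sub : ∀ p q → ℚ.- (p ℚ.- q) ≡ q ℚ.- p
  neg-sub = solve 2 (λ a b → :- (a :- b) := b :- a) refl

  sub-neg : ∀ p q → q ℚ.- p ≡ (ℚ.- p) ℚ.- (ℚ.- q)
  sub-neg = solve 2 (λ a b → b :- a := (:- a) :- (:- b)) refl

  sub-+ : ∀ p q r s → (p ℚ.- r) ℚ.+ (q ℚ.- s) ≡ (p ℚ.+ q) ℚ.- (r ℚ.+ s)
  sub-+ = solve 4 (λ a b a′ b′ → (a :- a′) :+ (b :- b′) := (a :+ b) :- (a′ :+ b′)) refl

  sub-* : ∀ p q r s → p ℚ.* (q ℚ.- s) ℚ.+ s ℚ.* (p ℚ.- r) ≡ p ℚ.* q ℚ.- r ℚ.* s
  sub-* = solve 4 (λ a b a′ b′ → a :* (b :- b′) :+ b′ :* (a :- a′) := a :* b :- a′ :* b′) refl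

  p≤∣p∣ : ∀ p → p ℚ.≤ ∣ p ∣
  p≤∣p∣ p with ℚ.≤-total 0ℚ p
  ... | inj₁ 0≤p = ℚ.≤-reflexive (sym (ℚ.0≤p⇒∣p∣≡p 0≤p))
  ... | inj₂ p≤0 = ℚ.≤-trans p≤0 (ℚ.0≤∣p∣ p)

  ∣p-q∣≡∣q-p∣ : ∀ p q → ∣ p ℚ.- q ∣ ≡ ∣ q ℚ.- p ∣
  ∣p-q∣≡∣q-p∣ p q = trans (sym (ℚ.∣-p∣≡∣p∣ (p ℚ.- q)))
    (cong ∣_∣ (neg-sub p q))

  dist-elim : ∀ {p q ε} → ∣ p ℚ.- q ∣ ℚ.≤ ε → p ℚ.≤ q ℚ.+ ε
  dist-elim {p} {q} {ε} h =
    subst (ℚ._≤ q ℚ.+ ε) (cancel p q)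
      (ℚ.+-monoʳ-≤ q (ℚ.≤-trans (p≤∣p∣ (p ℚ.- q)) h))

  diff≤ : ∀ {p q ε} → p ℚ.≤ q ℚ.+ ε → p ℚ.- q ℚ.≤ ε
  diff≤ {p} {q} {ε} h =
    subst (p ℚ.- q ℚ.≤_) (cancel′ q ε)
      (ℚ.+-monoˡ-≤ (ℚ.- q) h)

  dist-intro : ∀ {p q ε} → p ℚ.≤ q ℚ.+ ε → q ℚ.≤ p ℚ.+ ε → ∣ p ℚ.- q ∣ ℚ.≤ ε
  dist-intro {p} {q} {ε} h k with ℚ.∣p∣≡p∨∣p∣≡-p (p ℚ.- q)
  ... | inj₁ e = subst (ℚ._≤ ε) (sym e) (diff≤ {p} {q} h)
  ... | inj₂ e = subst (ℚ._≤ ε)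
    (sym (trans e (neg-sub p q)))
    (diff≤ {q} {p} k)

  ⊓-shift : ∀ {p q r s ε} → p ℚ.≤ r ℚ.+ ε → q ℚ.≤ s ℚ.+ ε → p ℚ.⊓ q ℚ.≤ (r ℚ.⊓ s) ℚ.+ ε
  ⊓-shift {p} {q} {r} {s} h k with ℚ.⊓-sel r s
  ... | inj₁ e rewrite e = ℚ.≤-trans (ℚ.p⊓q≤p p q) h
  ... | inj₂ e rewrite e = ℚ.≤-trans (ℚ.p⊓q≤q p q) k

  *-mono-nonNeg : ∀ {p q r s} → 0ℚ ℚ.≤ r → 0ℚ ℚ.≤ q → p ℚ.≤ q → r ℚ.≤ s → p ℚ.* r ℚ.≤ q ℚ.* s
  *-mono-nonNeg {p} {q} {r} {s} 0≤r 0≤q p≤q r≤s = ℚ.≤-trans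
    (ℚ.*-monoʳ-≤-nonNeg r {{nonNegative 0≤r}} p≤q)
    (ℚ.*-monoˡ-≤-nonNeg q {{nonNegative 0≤q}} r≤s)

  bounded : ∀ {s} → IsCauchy s →
    ∃[ B ] (0ℚ ℚ.< B × ∃[ N ] (∀ n → N ℕ.≤ n → ∣ s n ∣ ℚ.≤ B))
  bounded {s} c with c 1ℚ (ℚ.positive⁻¹ 1ℚ)
  ... | N , h = ∣ s N ∣ ℚ.+ 1ℚ
    , ℚ.+-mono-≤-< (ℚ.0≤∣p∣ (s N)) (ℚ.positive⁻¹ 1ℚ)
    , N , λ n N≤n → subst (λ z → ∣ z ∣ ℚ.≤ ∣ s N ∣ ℚ.+ 1ℚ)
        (cancel (s n) (s N))
        (ℚ.≤-trans (ℚ.∣p+q∣≤∣p∣+∣q∣ (s N) (s n ℚ.- s N))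
          (ℚ.+-monoʳ-≤ ∣ s N ∣ (h n N N≤n ℕ.≤-refl)))

  scale : ∀ {B ε} → 0ℚ ℚ.< B → 0ℚ ℚ.< ε → ∃[ δ ] (0ℚ ℚ.< δ × B ℚ.* δ ≡ ε)
  scale {B} {ε} 0<B 0<ε = (1/ B) ℚ.* ε
    , ℚ.positive⁻¹ _ {{ℚ.pos*pos⇒pos (1/ B) {{ℚ.1/pos⇒pos B}} ε}}
    , trans (sym (ℚ.*-assoc B (1/ B) ε))
        (trans (cong (ℚ._* ε) (ℚ.*-inverseʳ B)) (ℚ.*-identityˡ ε))
    where
    instance
      B-pos : Positive B
      B-pos = positive 0<B
      ε-pos : Positive ε
      ε-pos = positive 0<ε
      B-nz : NonZero B
      B-nz = ℚ.pos⇒nonZero B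

  const-cauchy : ∀ q → IsCauchy (λ _ → q)
  const-cauchy q ε 0<ε = 0 , λ _ _ _ _ →
    subst (λ z → ∣ z ∣ ℚ.≤ ε) (sym (ℚ.+-inverseʳ q)) (ℚ.<⇒≤ 0<ε)

  +-cauchy : ∀ {s t} → IsCauchy s → IsCauchy t → IsCauchy (λ n → s n ℚ.+ t n)
  +-cauchy {s} {t} c d ε 0<ε
    with c (½ ℚ.* ε) (half-pos 0<ε) | d (½ ℚ.* ε) (half-pos 0<ε)
  ... | N , h | M , k = N ℕ.⊔ M , λ m n p q →
    subst₂ (λ a b → ∣ a ∣ ℚ.≤ b)
      (sub-+ (s m) (t m) (s n) (t n))
      (halves ε)
      (ℚ.≤-trans (ℚ.∣p+q∣≤∣p∣+∣q∣ (s m ℚ.- s n) (t m ℚ.- t n))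
        (ℚ.+-mono-≤
          (h m n (ℕ.m⊔n≤o⇒m≤o N M p) (ℕ.m⊔n≤o⇒m≤o N M q))
          (k m n (ℕ.m⊔n≤o⇒n≤o N M p) (ℕ.m⊔n≤o⇒n≤o N M q))))

  neg-cauchy : ∀ {s} → IsCauchy s → IsCauchy (λ n → ℚ.- s n)
  neg-cauchy {s} c ε 0<ε with c ε 0<ε
  ... | N , h = N , λ m n p q → subst (λ z → ∣ z ∣ ℚ.≤ ε)
    (sub-neg (s m) (s n)) (h n m q p)

  ∣p*q∣≤ : ∀ p q {P Q} → 0ℚ ℚ.< P → ∣ p ∣ ℚ.≤ P → ∣ q ∣ ℚ.≤ Q → ∣ p ℚ.* q ∣ ℚ.≤ P ℚ.* Q
  ∣p*q∣≤ p q {P} {Q} 0<P hp hq = subst (ℚ._≤ P ℚ.* Q) (sym (ℚ.∣p*q∣≡∣p∣*∣q∣ p q))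
    (*-mono-nonNeg {∣ p ∣} {P} {∣ q ∣} {Q} (ℚ.0≤∣p∣ q) (ℚ.<⇒≤ 0<P) hp hq)

  *-dist : ∀ p q r s {B C δ η ε} → 0ℚ ℚ.< B → 0ℚ ℚ.< C →
    B ℚ.* δ ≡ ½ ℚ.* ε → C ℚ.* η ≡ ½ ℚ.* ε →
    ∣ p ∣ ℚ.≤ B → ∣ s ∣ ℚ.≤ C → ∣ q ℚ.- s ∣ ℚ.≤ δ → ∣ p ℚ.- r ∣ ℚ.≤ η →
    ∣ p ℚ.* q ℚ.- r ℚ.* s ∣ ℚ.≤ ε
  *-dist p q r s {B} {C} {δ} {η} {ε} 0<B 0<C Bδ Cη hp hs hqs hpr =
    subst₂ (λ a b → ∣ a ∣ ℚ.≤ b) (sub-* p q r s)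
      (trans (cong₂ ℚ._+_ Bδ Cη) (halves ε))
      (ℚ.≤-trans (ℚ.∣p+q∣≤∣p∣+∣q∣ (p ℚ.* (q ℚ.- s)) (s ℚ.* (p ℚ.- r)))
        (ℚ.+-mono-≤ (∣p*q∣≤ p (q ℚ.- s) 0<B hp hqs) (∣p*q∣≤ s (p ℚ.- r) 0<C hs hpr)))

  *-cauchy : ∀ {s t} → IsCauchy s → IsCauchy t → IsCauchy (λ n → s n ℚ.* t n)
  *-cauchy {s} {t} c d ε 0<ε =
    let B , 0<B , N₁ , hB = bounded {s} c
        C , 0<C , N₂ , hC = bounded {t} d
        δ , 0<δ , Bδ = scale 0<B (half-pos 0<ε)
        η , 0<η , Cη = scale 0<C (half-pos 0<ε)
        N₃ , h = d δ 0<δ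
        N₄ , k = c η 0<η
        left : ∀ {m} → (N₁ ℕ.⊔ N₂) ℕ.⊔ (N₃ ℕ.⊔ N₄) ℕ.≤ m → N₁ ℕ.⊔ N₂ ℕ.≤ m
        left = ℕ.m⊔n≤o⇒m≤o (N₁ ℕ.⊔ N₂) (N₃ ℕ.⊔ N₄)
        right : ∀ {m} → (N₁ ℕ.⊔ N₂) ℕ.⊔ (N₃ ℕ.⊔ N₄) ℕ.≤ m → N₃ ℕ.⊔ N₄ ℕ.≤ m
        right = ℕ.m⊔n≤o⇒n≤o (N₁ ℕ.⊔ N₂) (N₃ ℕ.⊔ N₄)
    in (N₁ ℕ.⊔ N₂) ℕ.⊔ (N₃ ℕ.⊔ N₄) , λ m n p q →
      *-dist (s m) (t m) (s n) (t n) {B} {C} {δ} {η} {ε} 0<B 0<C Bδ Cη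
        (hB m (ℕ.m⊔n≤o⇒m≤o N₁ N₂ (left p)))
        (hC n (ℕ.m⊔n≤o⇒n≤o N₁ N₂ (left q)))
        (h m n (ℕ.m⊔n≤o⇒m≤o N₃ N₄ (right p)) (ℕ.m⊔n≤o⇒m≤o N₃ N₄ (right q)))
        (k m n (ℕ.m⊔n≤o⇒n≤o N₃ N₄ (right p)) (ℕ.m⊔n≤o⇒n≤o N₃ N₄ (right q)))

  ⊓-cauchy : ∀ {s t} → IsCauchy s → IsCauchy t → IsCauchy (λ n → s n ℚ.⊓ t n)
  ⊓-cauchy {s} {t} c d ε 0<ε with c ε 0<ε | d ε 0<ε
  ... | N , h | M , k = N ℕ.⊔ M , λ m n p q → dist-intro {s m ℚ.⊓ t m} {s n ℚ.⊓ t n} (half m n p q) (half n m q p)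
    where
    half : ∀ m n → N ℕ.⊔ M ℕ.≤ m → N ℕ.⊔ M ℕ.≤ n →
           s m ℚ.⊓ t m ℚ.≤ (s n ℚ.⊓ t n) ℚ.+ ε
    half m n p q = ⊓-shift {s m} {t m} {s n} {t n}
      (dist-elim {s m} {s n} (h m n (ℕ.m⊔n≤o⇒m≤o N M p) (ℕ.m⊔n≤o⇒m≤o N M q)))
      (dist-elim {t m} {t n} (k m n (ℕ.m⊔n≤o⇒n≤o N M p) (ℕ.m⊔n≤o⇒n≤o N M q)))

infixl 6 _+_ _-_
infixl 7 _*_ _⊓_

fromℚ : ℚ → ℝ
fromℚ q = mkℝ (λ _ → q) (const-cauchy q)

0ℝ 1ℝ : ℝ
0ℝ = fromℚ 0ℚ
1ℝ = fromℚ 1ℚ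

_+_ : ℝ → ℝ → ℝ
x + y = mkℝ (λ n → seq x n ℚ.+ seq y n) (+-cauchy {seq x} {seq y} (cauchy x) (cauchy y))

-_ : ℝ → ℝ
- x = mkℝ (λ n → ℚ.- seq x n) (neg-cauchy {seq x} (cauchy x))

_-_ : ℝ → ℝ → ℝ
x - y = x + (- y)

_*_ : ℝ → ℝ → ℝ
x * y = mkℝ (λ n → seq x n ℚ.* seq y n) (*-cauchy {seq x} {seq y} (cauchy x) (cauchy y))

_⊓_ : ℝ → ℝ → ℝ
x ⊓ y = mkℝ (λ n → seq x n ℚ.⊓ seq y n) (⊓-cauchy {seq x} {seq y} (cauchy x) (cauchy y))

sum product : List ℝ → ℝ
sum     = foldr _+_ 0ℝ
product = foldr _*_ 1ℝ

------------------------------------------------------------------------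
-- Permutations

-- Every permutation of Fin (suc n) is insert 0F j π for a unique image j
-- of 0F and a unique permutation π of Fin n.

permutations : ∀ n → List (Permutation′ n)
permutations zero    = [ id ]
permutations (suc n) =
  concatMap (λ j → map (insert 0F j) (permutations n)) (allFin (suc n))

_ : map (λ σ → tabulate (σ ⟨$⟩ʳ_)) (permutations 3) ≡
      (0F ∷ 1F ∷ 2F ∷ []) ∷ (0F ∷ 2F ∷ 1F ∷ []) ∷
      (1F ∷ 0F ∷ 2F ∷ []) ∷ (1F ∷ 2F ∷ 0F ∷ []) ∷
      (2F ∷ 0F ∷ 1F ∷ []) ∷ (2F ∷ 1F ∷ 0F ∷ []) ∷ []
_ = refl

------------------------------------------------------------------------
-- The functions F, F′, d₃ and C₃

11/6 6/11 5/11 : ℝ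
11/6 = fromℚ (+ 11 / 6)
6/11 = fromℚ (+ 6 / 11)
5/11 = fromℚ (+ 5 / 11)

-- F, F′ and d₃ are given by their formulas on all of ℝ; only their values
-- on [0,1], respectively on the simplex, are meant.

F : ℝ → ℝ
F z = (11/6 * z) ⊓ 1ℝ

_∈[0,6/11] : ℝ → Set
z ∈[0,6/11] = (0ℝ ≤ z) × (z ≤ 6/11)

-- F′ is discontinuous, so without excluded middle it is only defined where
-- membership in [0,6/11] is decided. Its value does not depend on which
-- decision is supplied, and classically one always exists.

F′ : (z : ℝ) → Dec (z ∈[0,6/11]) → ℝ
F′ z (yes _) = 11/6
F′ z (no  _) = 0ℝ

-- The product of 1 - F (xᵢ) over all i with σ(i) < σ(k).

before : (Fin 3 → ℝ) → Permutation′ 3 → Fin 3 → ℝ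
before x σ k = product
  (map (λ i → 1ℝ - F (x i))
       (filter (λ i → (σ ⟨$⟩ʳ i) <? (σ ⟨$⟩ʳ k)) (allFin 3)))

-- The indices 1, 2, 3 are 0F, 1F, 2F.

d₃ : (x₁ x₂ x₃ : ℝ) → Dec (x₁ ∈[0,6/11]) → Dec (x₂ ∈[0,6/11]) → ℝ
d₃ x₁ x₂ x₃ δ₁ δ₂ = fromℚ (+ 1 / 3 !) *
  sum (map (λ σ → F′ x₁ δ₁ * before x σ 0F + F′ x₂ δ₂ * before x σ 1F)
           (permutations 3))
  where
  x : Fin 3 → ℝ
  x = lookup (x₁ ∷ x₂ ∷ x₃ ∷ [])

C₃ : (x₁ x₂ : ℝ) → Dec (x₁ ∈[0,6/11]) → Dec (x₂ ∈[0,6/11]) → ℝ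
C₃ x₁ x₂ δ₁ δ₂ = d₃ x₁ x₂ (1ℝ - x₁ - x₂) δ₁ δ₂

{-# OPTIONS --safe #-}
-- Since x₁ + x₂ ≤ 5/11 forces x₃ = 1 - x₁ - x₂ ≥ 6/11, the factor 1 - F(x₃)
-- vanishes.  Writing p, q, c for 1 - F(xᵢ), the two halves of the sum over
-- permutations are F′(x₁)(2 + q + c + 2qc) and F′(x₂)(2 + p + c + 2pc); with
-- c = 0, p, q ≤ 1 and F′ ≤ 11/6 the total is at most 6 · 11/6.  On
-- approximating sequences this is run with p, q ≤ 1 + η and c ≤ η.
module Submission where

open import Defs
open import Data.Integer.Base using (+_)
import Data.Nat.Base as ℕ
import Data.Nat.Properties as ℕ
open import Data.Product.Base using (_×_; _,_)
open import Data.Rational.Base using (ℚ; 0ℚ; 1ℚ; _/_; nonNegative; positive)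
import Data.Rational.Base as ℚ
import Data.Rational.Properties as ℚ
open import Data.Rational.Solver using (module +-*-Solver)
open import Data.Sum.Base using (inj₁; inj₂)
open import Relation.Binary.PropositionalEquality using (_≡_; refl; sym; subst; subst₂)
open import Relation.Nullary.Decidable using (Dec; yes; no; toWitness)

open +-*-Solver using (solve; con; _:=_; _:+_; _:*_; _:-_)

*-mono-≤-nonNeg : ∀ {p q r s} → 0ℚ ℚ.≤ r → 0ℚ ℚ.≤ q →
  p ℚ.≤ q → r ℚ.≤ s → p ℚ.* r ℚ.≤ q ℚ.* s
*-mono-≤-nonNeg {p} {q} {r} {s} 0≤r 0≤q p≤q r≤s = ℚ.≤-trans
  (ℚ.*-monoʳ-≤-nonNeg r {{nonNegative 0≤r}} p≤q)
  (ℚ.*-monoˡ-≤-nonNeg q {{nonNegative 0≤q}} r≤s)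

0<⊓ : ∀ {p q} → 0ℚ ℚ.< p → 0ℚ ℚ.< q → 0ℚ ℚ.< p ℚ.⊓ q
0<⊓ {p} {q} 0<p 0<q with ℚ.⊓-sel p q
... | inj₁ e = subst (0ℚ ℚ.<_) (sym e) 0<p
... | inj₂ e = subst (0ℚ ℚ.<_) (sym e) 0<q

0<* : ∀ {p q} → 0ℚ ℚ.< p → 0ℚ ℚ.< q → 0ℚ ℚ.< p ℚ.* q
0<* {p} {q} 0<p 0<q =
  ℚ.positive⁻¹ _ {{ℚ.pos*pos⇒pos p {{positive 0<p}} q {{positive 0<q}}}}

r : ℚ
r = + 11 / 6

1-Fℚ : ℚ → ℚ
1-Fℚ s = 1ℚ ℚ.- ((r ℚ.* s) ℚ.⊓ 1ℚ)

-- The cap at 1 gives this for every `s`, so terms of an approximating sequence that fall outside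
-- [0,1] do no harm.
0≤1-Fℚ : ∀ s → 0ℚ ℚ.≤ 1-Fℚ s
0≤1-Fℚ s = subst (ℚ._≤ 1-Fℚ s) (ℚ.+-inverseʳ 1ℚ)
  (ℚ.+-monoʳ-≤ 1ℚ (ℚ.neg-antimono-≤ (ℚ.p⊓q≤q (r ℚ.* s) 1ℚ)))

-- Scaling the hypothesis by 11/6 puts `1 - v` below `r * s`, and `0 ≤ v` puts it below 1, hence
-- below their minimum. It is used with `v = 1 + η` for x₁, x₂ and with `v = η` for x₃.
1-Fℚ≤ : ∀ s v → 0ℚ ℚ.≤ v → (+ 6 / 11) ℚ.* (1ℚ ℚ.- v) ℚ.≤ s → 1-Fℚ s ℚ.≤ v
1-Fℚ≤ s v 0≤v h = subst (1-Fℚ s ℚ.≤_)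
  (solve 1 (λ v → con 1ℚ :- (con 1ℚ :- v) := v) refl v)
  (ℚ.+-monoʳ-≤ 1ℚ (ℚ.neg-antimono-≤ (ℚ.⊓-glb below-rs below-1)))
  where
  below-rs : 1ℚ ℚ.- v ℚ.≤ r ℚ.* s
  below-rs = subst (ℚ._≤ r ℚ.* s)
    (solve 1 (λ v → con r :* (con (+ 6 / 11) :* (con 1ℚ :- v)) := con 1ℚ :- v) refl v)
    (ℚ.*-monoˡ-≤-nonNeg r h)
  below-1 : 1ℚ ℚ.- v ℚ.≤ 1ℚ
  below-1 = ℚ.+-monoʳ-≤ 1ℚ (ℚ.neg-antimono-≤ 0≤v)

-- Six times the part of d₃ carrying φ = F′(x₁); exchanging x₁ and x₂ gives the other part.
half : ℚ → ℚ → ℚ → ℚ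
half φ q c = φ ℚ.* ((+ 2 / 1) ℚ.+ q ℚ.+ c ℚ.+ (+ 2 / 1) ℚ.* (q ℚ.* c))

half≤ : ∀ {φ q c η} → 0ℚ ℚ.≤ φ → φ ℚ.≤ r → 0ℚ ℚ.≤ q → 0ℚ ℚ.≤ c →
  q ℚ.≤ 1ℚ ℚ.+ η → c ℚ.≤ η → η ℚ.≤ 1ℚ →
  half φ q c ℚ.≤ r ℚ.* ((+ 3 / 1) ℚ.+ (+ 6 / 1) ℚ.* η)
half≤ {φ} {q} {c} {η} 0≤φ φ≤r 0≤q 0≤c q≤ c≤ η≤1 = *-mono-≤-nonNeg
  {φ} {r}
  (ℚ.+-mono-≤ (ℚ.+-mono-≤ (ℚ.+-mono-≤ (toWitness {a? = 0ℚ ℚ.≤? (+ 2 / 1)} _) 0≤q) 0≤c)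
    (ℚ.*-monoˡ-≤-nonNeg (+ 2 / 1) 0≤qc))
  (toWitness {a? = 0ℚ ℚ.≤? r} _) φ≤r
  (subst ((+ 2 / 1) ℚ.+ q ℚ.+ c ℚ.+ (+ 2 / 1) ℚ.* (q ℚ.* c) ℚ.≤_)
    (solve 1 (λ η → con (+ 2 / 1) :+ (con 1ℚ :+ η) :+ η :+ con (+ 2 / 1) :* (con (+ 2 / 1) :* η)
                 := con (+ 3 / 1) :+ con (+ 6 / 1) :* η) refl η)
    (ℚ.+-mono-≤ (ℚ.+-mono-≤ (ℚ.+-monoʳ-≤ (+ 2 / 1) q≤) c≤)
      (ℚ.*-monoˡ-≤-nonNeg (+ 2 / 1) qc≤2η)))
  where
  0≤qc : 0ℚ ℚ.≤ q ℚ.* c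
  0≤qc = subst (ℚ._≤ q ℚ.* c) (ℚ.*-zeroʳ q)
    (ℚ.*-monoˡ-≤-nonNeg q {{nonNegative 0≤q}} 0≤c)
  -- Here `η ≤ 1` turns `(1 + η) * η` into a bound linear in `η`.
  qc≤2η : q ℚ.* c ℚ.≤ (+ 2 / 1) ℚ.* η
  qc≤2η = *-mono-≤-nonNeg {q} {+ 2 / 1} 0≤c (toWitness {a? = 0ℚ ℚ.≤? (+ 2 / 1)} _)
    (ℚ.≤-trans q≤ (ℚ.+-monoʳ-≤ 1ℚ η≤1)) c≤

-- Real arithmetic acts termwise and the permutations and filters compute, so this is a polynomial
-- identity in five rationals.
seq-C₃ : ∀ x₁ x₂ δ₁ δ₂ n → let s₁ = seq x₁ n; s₂ = seq x₂ n; c = 1-Fℚ (1ℚ ℚ.- s₁ ℚ.- s₂) in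
  seq (C₃ x₁ x₂ δ₁ δ₂) n ≡
  (+ 1 / 6) ℚ.* (half (seq (F′ x₁ δ₁) n) (1-Fℚ s₂) c ℚ.+ half (seq (F′ x₂ δ₂) n) (1-Fℚ s₁) c)
seq-C₃ x₁ x₂ δ₁ δ₂ n = solve 5 (λ φ ψ p q c →
    let 1′ = con 1ℚ; 2′ = con (+ 2 / 1) in
    con (+ 1 / 6) :*
      -- One summand per permutation, in the order of `permutations 3`; the trailing `1′` and the
      -- last `con 0ℚ` are the base cases of the folds.
      ( (φ :* 1′ :+ ψ :* (p :* 1′))
     :+ ((φ :* 1′ :+ ψ :* (p :* (c :* 1′)))
     :+ ((φ :* (q :* 1′) :+ ψ :* 1′)
     :+ ((φ :* (c :* 1′) :+ ψ :* (p :* (c :* 1′)))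
     :+ ((φ :* (q :* (c :* 1′)) :+ ψ :* 1′)
     :+ ((φ :* (q :* (c :* 1′)) :+ ψ :* (c :* 1′))
     :+ con 0ℚ))))))
    := con (+ 1 / 6) :* (φ :* (2′ :+ q :+ c :+ 2′ :* (q :* c)) :+ ψ :* (2′ :+ p :+ c :+ 2′ :* (p :* c))))
  refl (seq (F′ x₁ δ₁) n) (seq (F′ x₂ δ₂) n)
  (1-Fℚ (seq x₁ n)) (1-Fℚ (seq x₂ n)) (1-Fℚ (1ℚ ℚ.- seq x₁ n ℚ.- seq x₂ n))

0≤F′ : ∀ x δ n → 0ℚ ℚ.≤ seq (F′ x δ) n
0≤F′ x (yes _) n = toWitness {a? = 0ℚ ℚ.≤? r} _
0≤F′ x (no _)  n = ℚ.≤-refl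

F′≤11/6 : ∀ x δ n → seq (F′ x δ) n ℚ.≤ r
F′≤11/6 x (yes _) n = ℚ.≤-refl
F′≤11/6 x (no _)  n = toWitness {a? = 0ℚ ℚ.≤? r} _

-- The slack 6/11 `η` becomes `η` after the slope 11/6 of F. The two halves then contribute error
-- 1/6 · 2 · 11/6 · 6 `η` = 11/3 `η`.
seq-C₃≤ : ∀ x₁ x₂ δ₁ δ₂ n η → 0ℚ ℚ.≤ η → η ℚ.≤ 1ℚ →
  0ℚ ℚ.≤ seq x₁ n ℚ.+ (+ 6 / 11) ℚ.* η →
  0ℚ ℚ.≤ seq x₂ n ℚ.+ (+ 6 / 11) ℚ.* η →
  seq x₁ n ℚ.+ seq x₂ n ℚ.≤ (+ 5 / 11) ℚ.+ (+ 6 / 11) ℚ.* η →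
  seq (C₃ x₁ x₂ δ₁ δ₂) n ℚ.≤ r ℚ.+ (+ 11 / 3) ℚ.* η
seq-C₃≤ x₁ x₂ δ₁ δ₂ n η 0≤η η≤1 h₁ h₂ h₁₂ =
  subst₂ ℚ._≤_ (sym (seq-C₃ x₁ x₂ δ₁ δ₂ n))
    (solve 1 (λ η → con (+ 1 / 6) :* (con r :* (con (+ 3 / 1) :+ con (+ 6 / 1) :* η)
                                   :+ con r :* (con (+ 3 / 1) :+ con (+ 6 / 1) :* η))
                 := con r :+ con (+ 11 / 3) :* η) refl η)
    (ℚ.*-monoˡ-≤-nonNeg (+ 1 / 6) (ℚ.+-mono-≤
      (half≤ (0≤F′ x₁ δ₁ n) (F′≤11/6 x₁ δ₁ n) (0≤1-Fℚ s₂) (0≤1-Fℚ s₃) (near1 s₂ h₂) c≤η η≤1)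
      (half≤ (0≤F′ x₂ δ₂ n) (F′≤11/6 x₂ δ₂ n) (0≤1-Fℚ s₁) (0≤1-Fℚ s₃) (near1 s₁ h₁) c≤η η≤1)))
  where
  s₁ s₂ s₃ : ℚ
  s₁ = seq x₁ n
  s₂ = seq x₂ n
  s₃ = 1ℚ ℚ.- s₁ ℚ.- s₂

  near1 : ∀ s → 0ℚ ℚ.≤ s ℚ.+ (+ 6 / 11) ℚ.* η → 1-Fℚ s ℚ.≤ 1ℚ ℚ.+ η
  near1 s h = 1-Fℚ≤ s (1ℚ ℚ.+ η) (ℚ.+-mono-≤ (toWitness {a? = 0ℚ ℚ.≤? 1ℚ} _) 0≤η)
    (subst₂ ℚ._≤_
      (solve 1 (λ η → con 0ℚ :- con (+ 6 / 11) :* η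
                   := con (+ 6 / 11) :* (con 1ℚ :- (con 1ℚ :+ η))) refl η)
      (solve 2 (λ s η → (s :+ con (+ 6 / 11) :* η) :- con (+ 6 / 11) :* η := s) refl s η)
      (ℚ.+-monoˡ-≤ (ℚ.- ((+ 6 / 11) ℚ.* η)) h))

  -- Since 1 - 5/11 = 6/11, `h₁₂` gives exactly `s₃ ≥ 6/11 * (1 - η)`.
  c≤η : 1-Fℚ s₃ ℚ.≤ η
  c≤η = 1-Fℚ≤ s₃ η 0≤η
    (subst₂ ℚ._≤_
      (solve 1 (λ η → con 1ℚ :- (con (+ 5 / 11) :+ con (+ 6 / 11) :* η)
                   := con (+ 6 / 11) :* (con 1ℚ :- η)) refl η)
      (solve 2 (λ s t → con 1ℚ :- (s :+ t) := con 1ℚ :- s :- t) refl s₁ s₂)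
      (ℚ.+-monoʳ-≤ 1ℚ (ℚ.neg-antimono-≤ h₁₂)))

fromℚ-mono-≤ : ∀ {p q} → p ℚ.≤ q → fromℚ p ≤ fromℚ q
fromℚ-mono-≤ {p} {q} p≤q ε 0<ε = 0 , λ _ _ →
  subst (ℚ._≤ q ℚ.+ ε) (ℚ.+-identityʳ p) (ℚ.+-mono-≤ p≤q (ℚ.<⇒≤ 0<ε))

C₃≤11/6 : ∀ x₁ x₂ δ₁ δ₂ → 0ℝ ≤ x₁ → 0ℝ ≤ x₂ → x₁ + x₂ ≤ 5/11 → C₃ x₁ x₂ δ₁ δ₂ ≤ 11/6
C₃≤11/6 x₁ x₂ δ₁ δ₂ 0≤x₁ 0≤x₂ x₁+x₂≤ ε 0<ε =
  let N₁ , h₁  = 0≤x₁ δ 0<δ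
      N₂ , h₂  = 0≤x₂ δ 0<δ
      N₃ , h₁₂ = x₁+x₂≤ δ 0<δ
  in N₁ ℕ.⊔ N₂ ℕ.⊔ N₃ , λ n N≤n →
    let N₁₂≤n = ℕ.m⊔n≤o⇒m≤o (N₁ ℕ.⊔ N₂) N₃ N≤n in
    ℚ.≤-trans
      (seq-C₃≤ x₁ x₂ δ₁ δ₂ n η (ℚ.<⇒≤ 0<η) (ℚ.p⊓q≤q ((+ 3 / 11) ℚ.* ε) 1ℚ)
        (h₁ n (ℕ.m⊔n≤o⇒m≤o N₁ N₂ N₁₂≤n))
        (h₂ n (ℕ.m⊔n≤o⇒n≤o N₁ N₂ N₁₂≤n))
        (h₁₂ n (ℕ.m⊔n≤o⇒n≤o (N₁ ℕ.⊔ N₂) N₃ N≤n)))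
      (ℚ.+-monoʳ-≤ r 11/3η≤ε)
  where
  η δ : ℚ
  -- The factor 3/11 cancels the 11/3 in the error of `seq-C₃≤`, and the cap supplies `η ≤ 1`.
  η = ((+ 3 / 11) ℚ.* ε) ℚ.⊓ 1ℚ
  δ = (+ 6 / 11) ℚ.* η

  0<η : 0ℚ ℚ.< η
  0<η = 0<⊓ {(+ 3 / 11) ℚ.* ε} {1ℚ} (0<* {+ 3 / 11} (ℚ.positive⁻¹ (+ 3 / 11)) 0<ε) (ℚ.positive⁻¹ 1ℚ)

  0<δ : 0ℚ ℚ.< δ
  0<δ = 0<* {+ 6 / 11} {η} (ℚ.positive⁻¹ (+ 6 / 11)) 0<η

  11/3η≤ε : (+ 11 / 3) ℚ.* η ℚ.≤ ε
  11/3η≤ε = subst ((+ 11 / 3) ℚ.* η ℚ.≤_)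
    (solve 1 (λ ε → con (+ 11 / 3) :* (con (+ 3 / 11) :* ε) := ε) refl ε)
    (ℚ.*-monoˡ-≤-nonNeg (+ 11 / 3) (ℚ.p⊓q≤p ((+ 3 / 11) ℚ.* ε) 1ℚ))

lemma6p7 : (x₁ x₂ : ℝ) (δ₁ : Dec (x₁ ∈[0,6/11])) (δ₂ : Dec (x₂ ∈[0,6/11])) →
    0ℝ ≤ x₁ → 0ℝ ≤ x₂ → x₁ + x₂ ≤ 5/11 →
    (C₃ x₁ x₂ δ₁ δ₂ ≤ 11/6) × (11/6 ≤ fromℚ (+ 2012096 / 1000000))
lemma6p7 x₁ x₂ δ₁ δ₂ 0≤x₁ 0≤x₂ x₁+x₂≤ =
  C₃≤11/6 x₁ x₂ δ₁ δ₂ 0≤x₁ 0≤x₂ x₁+x₂≤ ,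
  fromℚ-mono-≤ (toWitness {a? = r ℚ.≤? (+ 2012096 / 1000000)} _)
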